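{- The second moment of the one-parameter family $E: y^2=4x^3+ax^2+bx+c+dt$ (with parameter $t$ and integer coefficients $a,b,c,d$) is $$A_{2,E}(p)=\begin{cases} p^2-p-p\left(\frac{ -48}{p}\right)-p\left(\frac{a^2-12b}{p}\right) & \text{if } a^2-12b\neq 0,\\[4pt] p^2-p+p(p-1)\left(\frac{ -48}{p}\right) & \text{otherwise.}\end{cases}$$
   Context: Here $p$ is an odd prime and $\left(\frac{\cdot}{p}\right)$ denotes the Legendre symbol, with $\left(\frac{u}{p}\right)=0$ if $p\mid u$. For a family $y^2=f_t(x)$, with $f_t(x)$ a cubic polynomial in $x$ whose coefficients are integer polynomials in $t$, one sets $a_t(p):=p-\#\{(x,y)\in(\mathbb{Z}/p\mathbb{Z})^2: y^2\equiv f_t(x) \bmod p\}=-\sum_{x \bmod p}\left(\frac{f_t(x)}{p}\right)$. The second moment is taken here without averaging over $t$: $A_{2,E}(p):=\sum_{t \bmod p}a_t(p)^2$, the sum running over all residues $t$ modulo $p$.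
   Formalization: The condition a²-12b ≠ 0 is read modulo p, and p ≠ 3 and p ∤ d are added: for p = 3 with 3 ∤ d the formula is always false, and for p | d the family is constant mod p and the formula fails in general (p=5, a=c=d=0, b=1: 20, not 30). -}

module Defs where

open import Data.Bool.Base using (if_then_else_)
open import Data.Fin.Base using (Fin; toℕ)
open import Data.Fin.Properties using (any?)
open import Data.Integer.Base using (ℤ; +_; _+_; _-_; _*_; _^_; -1ℤ; 0ℤ; 1ℤ)
open import Data.Integer.Divisibility.Signed using (_∣_; _∣?_)
open import Data.Integer.Properties using (+-0-commutativeMonoid)
open import Data.List.Base using (allFin; cartesianProduct; filter; length)
open import Data.Nat.Base using (ℕ)
open import Data.Product.Base using (_,_)
open import Relation.Nullary.Decidable using (Dec; does)

open import Algebra.Properties.CommutativeMonoid.Sum +-0-commutativeMonoid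
  using (sum)

infix 4 _≡_mod_ _≡?_mod_

_≡_mod_ : ℤ → ℤ → ℕ → Set
u ≡ v mod p = + p ∣ u - v

_≡?_mod_ : ∀ u v p → Dec (u ≡ v mod p)
u ≡? v mod p = + p ∣? (u - v)

-- Fin p stands for ℤ/pℤ through the representatives 0, …, p - 1.
rep : ∀ {p} → Fin p → ℤ
rep i = + toℕ i

-- The Legendre symbol (u/p); meaningful for p an odd prime.
legendre : ℤ → ℕ → ℤ
legendre u p =
  if does (+ p ∣? u) then 0ℤ else
  if does (any? λ (y : Fin p) → rep y ^ 2 ≡? u mod p) then 1ℤ else
  -1ℤ

-- A family y² = f t x.  Only families polynomial in t and x are of interest:
-- for those, the quantities below do not depend on the choice of
-- representatives modulo p.
Family : Set
Family = ℤ → ℤ → ℤ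

#points : Family → (p : ℕ) → ℤ → ℕ
#points f p t =
  length (filter (λ (x , y) → rep y ^ 2 ≡? f t (rep x) mod p)
                 (cartesianProduct (allFin p) (allFin p)))

aₜ : Family → (p : ℕ) → ℤ → ℤ
aₜ f p t = + p - + #points f p t

-- The second moment, not averaged over t.
A₂ : Family → ℕ → ℤ
A₂ f p = sum λ (t : Fin p) → aₜ f p (rep t) ^ 2

E : (a b c d : ℤ) → Family
E a b c d t x = + 4 * x ^ 3 + a * x ^ 2 + b * x + c + d * t

{-# OPTIONS --safe #-}

-- Let #√ u be the number of square roots of u modulo p, so that #√ u = 1 + (u/p).  The
-- correlation Σ_s #√ (u + s) #√ (v + s) counts the solutions of z² - w² = u - v, which factors
-- after the shift z ↦ z + w; hence the second moment of y² = F x + s only depends on the number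
-- of collisions F x = F y, for every function F.
--
-- For the cubic F, F (h + y) - F y is h times a quadratic in y of discriminant
-- - 48 h² + 4 (a² - 12 b), so the collisions are counted by the conic z² = k h² + m with k = - 48.
-- The same second moment, applied to F h = k h², shows that the point counts of these conics have
-- zero variance over m ≢ 0, which determines each of them.
module Submission where

open import Defs
open import Algebra.Bundles using (CommutativeRing)
open import Data.Bool.Base using (if_then_else_; true; false)
open import Data.Fin.Base using (Fin; zero; suc; toℕ; fromℕ<)
open import Data.Fin.Properties using (any?; toℕ<n; toℕ-injective; suc-injective; toℕ-fromℕ<)
open import Data.Integer.Base
  using (ℤ; +_; -[1+_]; -_; _+_; _-_; _*_; _^_; ∣_∣; 0ℤ; 1ℤ; -1ℤ)
open import Data.Integer.DivMod using (_%ℕ_; _/ℕ_; n%ℕd<d; a≡a%ℕn+[a/ℕn]*n)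
open import Data.Integer.Divisibility.Signed
  using (_∣_; _∣?_; divides; ∣⇒∣ᵤ; ∣ᵤ⇒∣; ∣m∣n⇒∣m+n; ∣m∣n⇒∣m-n; ∣m⇒∣-m; ∣n⇒∣m*n; ∣m⇒∣m*n)
open import Data.Integer.Properties
  using (+-*-commutativeRing; +-identityˡ; +-identityʳ; +-inverseʳ; *-identityˡ; *-identityʳ; *-zeroˡ;
         *-zeroʳ; *-comm; neg-involutive; +-injective; pos-*; abs-*; i-j≡0⇒i≡j; i*j≡0⇒i≡0∨j≡0;
         ∣i∣≡0⇒i≡0; m-n≡m⊖n; ∣m⊝n∣≤m⊔n)
open import Data.Integer.Tactic.RingSolver using (solve-∀)
open import Data.List.Base using (tabulate; map; filter; length; cartesianProduct; _++_)
open import Data.List.Properties using (map-tabulate; filter-++; length-++)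
open import Data.Nat.Base as ℕ using (ℕ; zero; suc)
open import Data.Nat.Coprimality using (coprime-Bézout; prime⇒coprime)
import Data.Nat.Divisibility as ℕ
open import Data.Nat.GCD using (module Bézout)
open import Data.Nat.Primality
  using (Prime; prime?; prime[2]; ¬prime[1]; euclidsLemma; prime⇒nonZero; prime⇒nonTrivial; prime⇒irreducible)
import Data.Nat.Properties as ℕ
open import Data.Product.Base using (∃; _×_; _,_)
open import Data.Sum.Base using (_⊎_; inj₁; inj₂; [_,_]′; reduce)
open import Function.Base using (_∘_; id)
open import Relation.Binary.PropositionalEquality
open import Relation.Nullary using (¬_; Dec; yes; no; does; contradiction)
open import Relation.Nullary.Decidable using (dec-true; dec-false; from-yes)
open import Relation.Unary using (Pred; Decidable)

open import Algebra.Properties.Semiring.Sum (CommutativeRing.semiring +-*-commutativeRing)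
  using (sum; sum-cong-≗; ∑-distrib-+; ∑-comm; *-distribˡ-sum; *-distribʳ-sum)

open ≡-Reasoning

-- Finite integer sums, counting by indicators, and sums of squares.

sum-const : ∀ n k → sum {n} (λ _ → k) ≡ + n * k
sum-const zero    k = sym (*-zeroˡ k)
sum-const (suc n) k = trans (cong (_+_ k) (sum-const n k)) (suc-step (+ n) k)
  where
  suc-step : ∀ m k → k + m * k ≡ (+ 1 + m) * k
  suc-step = solve-∀

sum-single : ∀ {n} (f : Fin n → ℤ) i → (∀ j → j ≢ i → f j ≡ 0ℤ) → sum f ≡ f i
sum-single {suc n} f zero    off =
  trans (cong (_+_ (f zero)) (trans (sum-cong-≗ λ j → off (suc j) λ ()) (trans (sum-const n 0ℤ) (*-zeroʳ (+ n)))))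
        (+-identityʳ _)
sum-single {suc n} f (suc i) off =
  trans (cong (_+ sum (f ∘ suc)) (off zero λ ()))
        (trans (+-identityˡ _) (sum-single (f ∘ suc) i λ j j≢i → off (suc j) (j≢i ∘ suc-injective)))

length-filter-tabulate : ∀ {a ℓ n} {A : Set a} {P : Pred A ℓ} (P? : Decidable P) (g : Fin n → A) →
  + length (filter P? (tabulate g)) ≡ sum (λ i → if does (P? (g i)) then 1ℤ else 0ℤ)
length-filter-tabulate {n = zero}  P? g = refl
length-filter-tabulate {n = suc n} P? g with ih ← length-filter-tabulate P? (g ∘ suc) | does (P? (g zero))
... | true  = cong (_+_ 1ℤ) ih
... | false = trans ih (sym (+-identityˡ _))

length-filter-cartesianProduct : ∀ {a b ℓ m n} {A : Set a} {B : Set b} {P : Pred (A × B) ℓ}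
  (P? : Decidable P) (g : Fin m → A) (h : Fin n → B) →
  + length (filter P? (cartesianProduct (tabulate g) (tabulate h))) ≡
  sum (λ i → sum (λ j → if does (P? (g i , h j)) then 1ℤ else 0ℤ))
length-filter-cartesianProduct {m = zero}  P? g h = refl
length-filter-cartesianProduct {m = suc m} P? g h = begin
  + length (filter P? (row ++ rows))
    ≡⟨ cong (λ xs → + length xs) (filter-++ P? row rows) ⟩
  + length (filter P? row ++ filter P? rows)
    ≡⟨ cong +_ (length-++ (filter P? row)) ⟩
  + length (filter P? row) + + length (filter P? rows)
    ≡⟨ cong₂ _+_ (trans (cong (λ xs → + length (filter P? xs)) (map-tabulate h (g zero ,_)))
                        (length-filter-tabulate P? (λ j → g zero , h j)))
                 (length-filter-cartesianProduct P? (g ∘ suc) h) ⟩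
  sum (λ i → sum (λ j → if does (P? (g i , h j)) then 1ℤ else 0ℤ)) ∎
  where
  row  = map (g zero ,_) (tabulate h)
  rows = cartesianProduct (tabulate (g ∘ suc)) (tabulate h)

square-nonneg : ∀ i → ∃ λ n → i * i ≡ + n
square-nonneg (+ n)    = n ℕ.* n , sym (pos-* n n)
square-nonneg -[1+ n ] = suc n ℕ.* suc n , refl

sum-squares-nonneg : ∀ {n} (f : Fin n → ℤ) → ∃ λ m → sum (λ i → f i * f i) ≡ + m
sum-squares-nonneg {zero}  f = 0 , refl
sum-squares-nonneg {suc n} f with square-nonneg (f zero) | sum-squares-nonneg (f ∘ suc)
... | k , f₀²≡k | l , rest≡l = k ℕ.+ l , cong₂ _+_ f₀²≡k rest≡l

-- This turns a vanishing variance into pointwise information: nonnegative terms with sum zero are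
-- all zero, and an integer with zero square is zero.
sum-squares≡0⇒≡0 : ∀ {n} (f : Fin n → ℤ) → sum (λ i → f i * f i) ≡ 0ℤ → ∀ i → f i ≡ 0ℤ
sum-squares≡0⇒≡0 {suc n} f Σ≡0 with square-nonneg (f zero) | sum-squares-nonneg (f ∘ suc)
... | k , f₀²≡k | l , rest≡l = λ where
    zero    → reduce (i*j≡0⇒i≡0∨j≡0 (f zero) (trans f₀²≡k (cong +_ (ℕ.m+n≡0⇒m≡0 k k+l≡0))))
    (suc i) → sum-squares≡0⇒≡0 (f ∘ suc) (trans rest≡l (cong +_ (ℕ.m+n≡0⇒n≡0 k k+l≡0))) i
  where
  k+l≡0 : k ℕ.+ l ≡ 0
  k+l≡0 = +-injective (trans (sym (cong₂ _+_ f₀²≡k rest≡l)) Σ≡0)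

-- The part of `E` free of `t`: `E a b c d t x` unfolds to `cubic a b c x + d * t`.
cubic : (a b c : ℤ) → ℤ → ℤ
cubic a b c x = + 4 * x ^ 3 + a * x ^ 2 + b * x + c

prime-∣⇒≡ : ∀ {p q} → Prime p → Prime q → + p ∣ + q → p ≡ q
prime-∣⇒≡ {p} {q} p-prime q-prime d with prime⇒irreducible q-prime (∣⇒∣ᵤ d)
... | inj₁ p≡1 = contradiction (subst Prime p≡1 p-prime) ¬prime[1]
... | inj₂ p≡q = p≡q

-- Congruences, representatives and inverses modulo a prime.

module Modulo (p : ℕ) (p-prime : Prime p) where

  private instance
    p≢0 : ℕ.NonZero p
    p≢0 = prime⇒nonZero p-prime

  infix 4 _≈_ p∣_ p∤_

  p∣_ p∤_ : ℤ → Set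
  p∣ u = + p ∣ u
  p∤ u = ¬ (p∣ u)

  -- u ≡ v mod p unfolds to a divisibility from which u and v cannot be inferred.
  record _≈_ (u v : ℤ) : Set where
    constructor cong-mod
    field ≈⇒∣ : p∣ u - v
  open _≈_ public

  ∣-≡ : ∀ {u v} → u ≡ v → p∣ u → p∣ v
  ∣-≡ = subst p∣_

  ≡⇒≈ : ∀ {u v} → u ≡ v → u ≈ v
  ≡⇒≈ {u} refl = cong-mod (divides 0ℤ (trans (+-inverseʳ u) (sym (*-zeroˡ (+ p)))))

  ≈-refl : ∀ {u} → u ≈ u
  ≈-refl = ≡⇒≈ refl

  ≈-sym : ∀ {u v} → u ≈ v → v ≈ u
  ≈-sym {u} {v} (cong-mod d) = cong-mod (∣-≡ (flip-sub u v) (∣m⇒∣-m d))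
    where
    flip-sub : ∀ u v → - (u - v) ≡ v - u
    flip-sub = solve-∀

  ≈-trans : ∀ {u v w} → u ≈ v → v ≈ w → u ≈ w
  ≈-trans {u} {v} {w} (cong-mod d) (cong-mod e) = cong-mod (∣-≡ (telescope u v w) (∣m∣n⇒∣m+n d e))
    where
    telescope : ∀ u v w → (u - v) + (v - w) ≡ u - w
    telescope = solve-∀

  +-≈ : ∀ {u u′ v v′} → u ≈ u′ → v ≈ v′ → u + v ≈ u′ + v′
  +-≈ {u} {u′} {v} {v′} (cong-mod d) (cong-mod e) = cong-mod (∣-≡ (regroup u u′ v v′) (∣m∣n⇒∣m+n d e))
    where
    regroup : ∀ u u′ v v′ → (u - u′) + (v - v′) ≡ (u + v) - (u′ + v′)
    regroup = solve-∀

  neg-≈ : ∀ {u v} → u ≈ v → - u ≈ - v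
  neg-≈ {u} {v} (cong-mod d) = cong-mod (∣-≡ (regroup u v) (∣m⇒∣-m d))
    where
    regroup : ∀ u v → - (u - v) ≡ (- u) - (- v)
    regroup = solve-∀

  *-≈ : ∀ {u u′ v v′} → u ≈ u′ → v ≈ v′ → u * v ≈ u′ * v′
  *-≈ {u} {u′} {v} {v′} (cong-mod d) (cong-mod e) =
    cong-mod (∣-≡ (regroup u u′ v v′) (∣m∣n⇒∣m+n (∣m⇒∣m*n v d) (∣n⇒∣m*n u′ e)))
    where
    regroup : ∀ u u′ v v′ → (u - u′) * v + u′ * (v - v′) ≡ u * v - u′ * v′
    regroup = solve-∀

  ∣⇒≈0 : ∀ {u} → p∣ u → u ≈ 0ℤ
  ∣⇒≈0 {u} = cong-mod ∘ ∣-≡ (sym (+-identityʳ u))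

  ≈0⇒∣ : ∀ {u} → u ≈ 0ℤ → p∣ u
  ≈0⇒∣ {u} = ∣-≡ (+-identityʳ u) ∘ ≈⇒∣

  ∣-≈ : ∀ {u v} → u ≈ v → p∣ u → p∣ v
  ∣-≈ u≈v p∣u = ≈0⇒∣ (≈-trans (≈-sym u≈v) (∣⇒≈0 p∣u))

  ∣-* : ∀ u v → p∣ u * v → p∣ u ⊎ p∣ v
  ∣-* u v d with euclidsLemma ∣ u ∣ ∣ v ∣ p-prime (subst (p ℕ.∣_) (abs-* u v) (∣⇒∣ᵤ d))
  ... | inj₁ e = inj₁ (∣ᵤ⇒∣ e)
  ... | inj₂ e = inj₂ (∣ᵤ⇒∣ e)

  ∤-* : ∀ u v → p∤ u → p∤ v → p∤ u * v
  ∤-* u v ∤u ∤v d = [ ∤u , ∤v ]′ (∣-* u v d)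

  ∣-cancelˡ : ∀ k u → p∤ k → p∣ k * u → p∣ u
  ∣-cancelˡ k u ∤k d with ∣-* k u d
  ... | inj₁ ∣k = contradiction ∣k ∤k
  ... | inj₂ ∣u = ∣u

  ∃-rep : ∀ u → ∃ λ (i : Fin p) → rep i ≈ u
  ∃-rep u = fromℕ< (n%ℕd<d u p) , ≈-sym (cong-mod (divides (u /ℕ p) quot))
    where
    cancel : ∀ a b → a + b - a ≡ b
    cancel = solve-∀
    quot : u - rep (fromℕ< (n%ℕd<d u p)) ≡ (u /ℕ p) * + p
    quot = trans (cong₂ _-_ (a≡a%ℕn+[a/ℕn]*n u p) (cong +_ (toℕ-fromℕ< (n%ℕd<d u p))))
                 (cancel (+ (u %ℕ p)) _)

  -- Two representatives differ by less than `p` in absolute value, and the only multiple of `p` in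
  -- that range is zero.
  rep-injective : ∀ {i j : Fin p} → rep i ≈ rep j → i ≡ j
  rep-injective {i} {j} (cong-mod d) = toℕ-injective (+-injective (i-j≡0⇒i≡j (rep i) (rep j) (∣i∣≡0⇒i≡0 distance≡0)))
    where
    distance<p : ∣ rep i - rep j ∣ ℕ.< p
    distance<p = subst (λ k → ∣ k ∣ ℕ.< p) (sym (m-n≡m⊖n (toℕ i) (toℕ j)))
      (ℕ.≤-<-trans (∣m⊝n∣≤m⊔n (toℕ i) (toℕ j)) (ℕ.⊔-pres-<m (toℕ<n i) (toℕ<n j)))
    small-multiple : ∀ {m} → p ℕ.∣ m → m ℕ.< p → m ≡ 0
    small-multiple {zero}  _   _   = refl
    small-multiple {suc m} p∣m m<p = contradiction p∣m (ℕ.>⇒∤ m<p)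
    distance≡0 : ∣ rep i - rep j ∣ ≡ 0
    distance≡0 = small-multiple (∣⇒∣ᵤ d) distance<p

  -- The representative of `u` is positive and below the prime `p`, hence coprime to it, and a
  -- Bézout identity supplies the inverse.
  ∃-inverse : ∀ u → p∤ u → ∃ λ v → u * v ≈ 1ℤ
  ∃-inverse u ∤u with ∃-rep u
  ... | i , i≈u = inv (toℕ i) (toℕ<n i) i≈u
    where
    pos-Bézout : ∀ i j k l → 1 ℕ.+ i ℕ.* j ≡ k ℕ.* l → 1ℤ + + i * + j ≡ + k * + l
    pos-Bézout i j k l e = trans (cong (_+_ 1ℤ) (sym (pos-* i j))) (trans (cong +_ e) (pos-* k l))
    inv : ∀ m → m ℕ.< p → + m ≈ u → ∃ λ v → u * v ≈ 1ℤ
    inv zero      _   0≈u = contradiction (≈0⇒∣ (≈-sym 0≈u)) ∤u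
    inv m@(suc _) m<p m≈u with coprime-Bézout (prime⇒coprime p-prime m<p)
    -- The identity here is `1 + y * m = x * p`, so the inverse is `- + y`; in the other case it is
    -- `1 + x * p = y * m`, so the inverse is `+ y`.
    ... | Bézout.+- x y eq = - + y ,
      ≈-trans (*-≈ (≈-sym m≈u) ≈-refl) (cong-mod (divides (- + x) (negated (+ x) (+ p) (pos-Bézout y m x p eq))))
      where
      pull-neg : ∀ i y → i * - y - 1ℤ ≡ - (1ℤ + y * i)
      pull-neg = solve-∀
      push-neg : ∀ x q → - (x * q) ≡ - x * q
      push-neg = solve-∀
      negated : ∀ x q → 1ℤ + + y * + m ≡ x * q → + m * - + y - 1ℤ ≡ - x * q
      negated x q e = trans (pull-neg (+ m) (+ y)) (trans (cong -_ e) (push-neg x q))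
    ... | Bézout.-+ x y eq = + y ,
      ≈-trans (*-≈ (≈-sym m≈u) ≈-refl) (cong-mod (divides (+ x) (moved (+ x) (+ p) (pos-Bézout x p y m eq))))
      where
      cancel-1 : ∀ i → 1ℤ + i - 1ℤ ≡ i
      cancel-1 = solve-∀
      moved : ∀ x q → 1ℤ + x * q ≡ + y * + m → + m * + y - 1ℤ ≡ x * q
      moved x q e = trans (cong (_- 1ℤ) (trans (*-comm (+ m) (+ y)) (sym e))) (cancel-1 (x * q))

  -- Sums over residues, indicators of divisibility and changes of variable.

  Periodic : (ℤ → ℤ) → Set
  Periodic g = ∀ {u v} → u ≈ v → g u ≡ g v

  ∑ : (ℤ → ℤ) → ℤ
  ∑ g = sum {p} (λ i → g (rep i))

  infix 10 ∑
  syntax ∑ (λ x → e) = ∑[ x ] e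

  ∑-cong : ∀ {g h : ℤ → ℤ} → (∀ x → g x ≡ h x) → ∑ g ≡ ∑ h
  ∑-cong g≗h = sum-cong-≗ {p} (λ i → g≗h (rep i))

  ∑-+ : ∀ g h → ∑[ x ] (g x + h x) ≡ ∑ g + ∑ h
  ∑-+ g h = ∑-distrib-+ {p} (λ i → g (rep i)) (λ i → h (rep i))

  ∑-*ˡ : ∀ k g → ∑[ x ] (k * g x) ≡ k * ∑ g
  ∑-*ˡ k g = sym (*-distribˡ-sum {p} k (λ i → g (rep i)))

  ∑-*ʳ : ∀ k g → ∑[ x ] (g x * k) ≡ ∑ g * k
  ∑-*ʳ k g = sym (*-distribʳ-sum {p} k (λ i → g (rep i)))

  ∑-const : ∀ k → ∑[ _ ] k ≡ + p * k
  ∑-const = sum-const p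

  ∑-swap : ∀ (f : ℤ → ℤ → ℤ) → ∑[ x ] (∑[ y ] (f x y)) ≡ ∑[ y ] (∑[ x ] (f x y))
  ∑-swap f = ∑-comm {p} {p} (λ i j → f (rep i) (rep j))

  ∑-product : ∀ g h → ∑ g * ∑ h ≡ ∑[ x ] (∑[ y ] (g x * h y))
  ∑-product g h = trans (sym (∑-*ʳ (∑ h) g)) (∑-cong λ x → sym (∑-*ˡ (g x) h))

  ∑-periodic : ∀ {f : ℤ → ℤ → ℤ} → (∀ y → Periodic (λ x → f x y)) → Periodic (λ x → ∑[ y ] (f x y))
  ∑-periodic per u≈v = ∑-cong λ y → per y u≈v

  -- Opaque, so that u can be inferred from δ u.
  opaque
    δ : ℤ → ℤ
    δ u = if does (+ p ∣? u) then 1ℤ else 0ℤ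

    δ-def : ∀ u → δ u ≡ (if does (+ p ∣? u) then 1ℤ else 0ℤ)
    δ-def _ = refl

    δ-∣ : ∀ {u} → p∣ u → δ u ≡ 1ℤ
    δ-∣ {u} p∣u = cong (if_then 1ℤ else 0ℤ) (dec-true (+ p ∣? u) p∣u)

    δ-∤ : ∀ {u} → p∤ u → δ u ≡ 0ℤ
    δ-∤ {u} p∤u = cong (if_then 1ℤ else 0ℤ) (dec-false (+ p ∣? u) p∤u)

  δ-⇔ : ∀ {u v} → (p∣ u → p∣ v) → (p∣ v → p∣ u) → δ u ≡ δ v
  δ-⇔ {u} {v} f g with + p ∣? u
  ... | yes p∣u = trans (δ-∣ p∣u) (sym (δ-∣ (f p∣u)))
  ... | no  p∤u = trans (δ-∤ p∤u) (sym (δ-∤ (p∤u ∘ g)))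

  δ-periodic : Periodic δ
  δ-periodic u≈v = δ-⇔ (∣-≈ u≈v) (∣-≈ (≈-sym u≈v))

  δ-neg : ∀ u → δ (- u) ≡ δ u
  δ-neg u = δ-⇔ (λ d → ∣-≡ (neg-involutive u) (∣m⇒∣-m d)) ∣m⇒∣-m

  δ-*ˡ : ∀ k u → p∤ k → δ (k * u) ≡ δ u
  δ-*ˡ k u p∤k = δ-⇔ (∣-cancelˡ k u p∤k) (∣n⇒∣m*n k)

  p∤1 : p∤ 1ℤ
  p∤1 d = ℕ.>⇒∤ (ℕ.nonTrivial⇒n>1 p {{prime⇒nonTrivial p-prime}}) (∣⇒∣ᵤ d)

  -- The unit `α` gives the root `- β / α`; any other root would differ from it by a class killed by
  -- `α`, so exactly one representative contributes.
  ∑-δ-affine : ∀ α β → p∤ α → ∑[ x ] (δ (α * x + β)) ≡ 1ℤ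
  ∑-δ-affine α β p∤α with ∃-inverse α p∤α
  ... | α⁻¹ , αα⁻¹≈1 with ∃-rep (α⁻¹ * - β)
  ...   | i , i≈root = trans (sum-single (λ j → δ (α * rep j + β)) i off) (δ-∣ (≈0⇒∣ root))
    where
    assoc-neg : ∀ α α⁻¹ β → α * (α⁻¹ * - β) + β ≡ α * α⁻¹ * - β + β
    assoc-neg = solve-∀
    inverse-neg : ∀ β → 1ℤ * - β + β ≡ 0ℤ
    inverse-neg = solve-∀
    difference : ∀ α β x y → (α * x + β) - (α * y + β) ≡ α * (x - y)
    difference = solve-∀
    root : α * rep i + β ≈ 0ℤ
    root = ≈-trans (+-≈ (*-≈ (≈-refl {α}) i≈root) (≈-refl {β}))
          (≈-trans (≡⇒≈ (assoc-neg α α⁻¹ β))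
          (≈-trans (+-≈ (*-≈ αα⁻¹≈1 (≈-refl { - β})) (≈-refl {β})) (≡⇒≈ (inverse-neg β))))
    off : ∀ j → j ≢ i → δ (α * rep j + β) ≡ 0ℤ
    off j j≢i = δ-∤ λ d → j≢i (rep-injective (cong-mod (∣-cancelˡ α (rep j - rep i) p∤α
      (∣-≡ (difference α β (rep j) (rep i)) (≈⇒∣ (≈-trans (∣⇒≈0 d) (≈-sym root)))))))

  ∑-δ : ∀ w → ∑[ x ] (δ (x - w)) ≡ 1ℤ
  ∑-δ w = trans (∑-cong λ x → cong (λ y → δ (y - w)) (sym (*-identityˡ x))) (∑-δ-affine 1ℤ (- w) p∤1)

  -- The indicator is supported on the class of `w`, where periodicity makes `G` constant, and
  -- exactly one representative lies in that class.
  ∑-sample : ∀ {G} → Periodic G → ∀ w → ∑[ s ] (δ (s - w) * G s) ≡ G w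
  ∑-sample {G} per w = begin
    ∑[ s ] (δ (s - w) * G s)  ≡⟨ ∑-cong localise ⟩
    ∑[ s ] (δ (s - w) * G w)  ≡⟨ ∑-*ʳ (G w) (λ s → δ (s - w)) ⟩
    ∑[ s ] (δ (s - w)) * G w  ≡⟨ cong (_* G w) (∑-δ w) ⟩
    1ℤ * G w                  ≡⟨ *-identityˡ (G w) ⟩
    G w                       ∎
    where
    localise : ∀ s → δ (s - w) * G s ≡ δ (s - w) * G w
    localise s with + p ∣? (s - w)
    ... | yes s≈w = cong (δ (s - w) *_) (per (cong-mod s≈w))
    ... | no  s≉w = trans (cong (_* G s) (δ-∤ s≉w)) (sym (cong (_* G w) (δ-∤ s≉w)))

  -- The weight at `s` is the size of the fibre of `φ` over `s`. Once the sums are interchanged,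
  -- each `z` samples `G` at `φ z`.
  ∑-pushforward : ∀ (φ : ℤ → ℤ) {G} → Periodic G →
    ∑[ s ] (∑[ z ] (δ (s - φ z)) * G s) ≡ ∑[ z ] (G (φ z))
  ∑-pushforward φ {G} per = begin
    ∑[ s ] (∑[ z ] (δ (s - φ z)) * G s)    ≡⟨ ∑-cong (λ s → ∑-*ʳ (G s) (λ z → δ (s - φ z))) ⟨
    ∑[ s ] (∑[ z ] (δ (s - φ z) * G s))    ≡⟨ ∑-swap (λ s z → δ (s - φ z) * G s) ⟩
    ∑[ z ] (∑[ s ] (δ (s - φ z) * G s))    ≡⟨ ∑-cong (λ z → ∑-sample per (φ z)) ⟩
    ∑[ z ] (G (φ z))                       ∎

  -- Pushforward along a map whose fibres all have size one.
  ∑-affine : ∀ α β → p∤ α → ∀ {g} → Periodic g → ∑[ x ] (g (α * x + β)) ≡ ∑ g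
  ∑-affine α β p∤α {g} per = begin
    ∑[ x ] (g (α * x + β))                          ≡⟨ ∑-pushforward (λ x → α * x + β) per ⟨
    ∑[ s ] (∑[ x ] (δ (s - (α * x + β))) * g s)     ≡⟨ ∑-cong (λ s → cong (_* g s) (fibre s)) ⟩
    ∑[ s ] (1ℤ * g s)                               ≡⟨ ∑-cong (λ s → *-identityˡ (g s)) ⟩
    ∑ g                                             ∎
    where
    flip-affine : ∀ s α β x → s - (α * x + β) ≡ - (α * x + (β - s))
    flip-affine = solve-∀
    fibre : ∀ s → ∑[ x ] (δ (s - (α * x + β))) ≡ 1ℤ
    fibre s = trans (∑-cong λ x → trans (cong δ (flip-affine s α β x)) (δ-neg _)) (∑-δ-affine α (β - s) p∤α)

  ∑-shift : ∀ β {g} → Periodic g → ∑[ x ] (g (x + β)) ≡ ∑ g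
  ∑-shift β {g} per = trans (∑-cong λ x → cong (λ y → g (y + β)) (sym (*-identityˡ x))) (∑-affine 1ℤ β p∤1 per)

  -- A formula `h` valid off the zero class is summed over all residues, and its value there is then
  -- exchanged for the true one, `b`.
  ∑-split : ∀ {g} b {h} → Periodic h → (∀ {x} → p∣ x → g x ≡ b) → (∀ {x} → p∤ x → g x ≡ h x) →
    ∑ g ≡ ∑ h + (b - h 0ℤ)
  ∑-split {g} b {h} per on off = begin
    ∑ g                                    ≡⟨ ∑-cong correct ⟩
    ∑[ x ] (h x + δ (x - 0ℤ) * (b - h x))  ≡⟨ ∑-+ h (λ x → δ (x - 0ℤ) * (b - h x)) ⟩
    ∑ h + ∑[ x ] (δ (x - 0ℤ) * (b - h x))  ≡⟨ cong (_+_ (∑ h)) (∑-sample (λ u≈v → cong (_-_ b) (per u≈v)) 0ℤ) ⟩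
    ∑ h + (b - h 0ℤ)                       ∎
    where
    on-eq : ∀ b h → b ≡ h + 1ℤ * (b - h)
    on-eq = solve-∀
    off-eq : ∀ b h → h ≡ h + 0ℤ * (b - h)
    off-eq = solve-∀
    correct : ∀ x → g x ≡ h x + δ (x - 0ℤ) * (b - h x)
    correct x with + p ∣? (x - 0ℤ)
    ... | yes d = trans (on (≈0⇒∣ (cong-mod d)))
                        (trans (on-eq b (h x)) (cong (λ e → h x + e * (b - h x)) (sym (δ-∣ d))))
    ... | no ¬d = trans (off (¬d ∘ ≈⇒∣ ∘ ∣⇒≈0))
                        (trans (off-eq b (h x)) (cong (λ e → h x + e * (b - h x)) (sym (δ-∤ ¬d))))

  ∑-split-const : ∀ {g} b c → (∀ {x} → p∣ x → g x ≡ b) → (∀ {x} → p∤ x → g x ≡ c) →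
    ∑ g ≡ b + (+ p - 1ℤ) * c
  ∑-split-const b c on off =
    trans (∑-split b {λ _ → c} (λ _ → refl) on off) (trans (cong (_+ (b - c)) (∑-const c)) (regroup (+ p) b c))
    where
    regroup : ∀ q b c → q * c + (b - c) ≡ b + (q - 1ℤ) * c
    regroup = solve-∀

-- Square roots modulo an odd prime and their correlations.

module OddModulo (p : ℕ) (p-prime : Prime p) (p-odd : ¬ + p ∣ + 2) where

  open Modulo p p-prime

  -- After `z ↦ z + w` the equation reads `z * (z + 2 w) = k`, which is linear in `w`. Each unit `z`
  -- admits one `w`, as 2 is invertible; for `z` in the zero class every `w` works or none does,
  -- according to whether `p` divides `k`.
  ∑∑-δ-diff-squares : ∀ k → ∑[ z ] (∑[ w ] (δ (z * z - w * w - k))) ≡ (+ p - 1ℤ) + + p * δ k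
  ∑∑-δ-diff-squares k = begin
    ∑[ z ] (∑[ w ] (δ (z * z - w * w - k)))              ≡⟨ ∑-swap (λ z w → δ (z * z - w * w - k)) ⟩
    ∑[ w ] (∑[ z ] (δ (z * z - w * w - k)))              ≡⟨ ∑-cong (λ w → ∑-shift w (periodic w)) ⟨
    ∑[ w ] (∑[ z ] (δ ((z + w) * (z + w) - w * w - k)))  ≡⟨ ∑-swap (λ z w → δ ((z + w) * (z + w) - w * w - k)) ⟨
    ∑[ z ] (∑[ w ] (δ ((z + w) * (z + w) - w * w - k)))  ≡⟨ ∑-split-const (+ p * δ k) 1ℤ on off ⟩
    + p * δ k + (+ p - 1ℤ) * 1ℤ                          ≡⟨ regroup (+ p) (δ k) ⟩
    (+ p - 1ℤ) + + p * δ k                               ∎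
    where
    diff-squares-∣ : ∀ z w k → (z + w) * (z + w) - w * w - k ≡ z * (z + + 2 * w) + - k
    diff-squares-∣ = solve-∀
    diff-squares-∤ : ∀ z w k → (z + w) * (z + w) - w * w - k ≡ + 2 * z * w + (z * z - k)
    diff-squares-∤ = solve-∀
    regroup : ∀ q d → q * d + (q - 1ℤ) * 1ℤ ≡ (q - 1ℤ) + q * d
    regroup = solve-∀
    periodic : ∀ w → Periodic (λ z → δ (z * z - w * w - k))
    periodic w u≈v = δ-periodic (+-≈ (+-≈ (*-≈ u≈v u≈v) ≈-refl) ≈-refl)
    on : ∀ {z} → p∣ z → ∑[ w ] (δ ((z + w) * (z + w) - w * w - k)) ≡ + p * δ k
    on {z} p∣z = trans (∑-cong λ w → trans (cong δ (diff-squares-∣ z w k)) (trans (δ-periodic (drop w)) (δ-neg k)))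
                       (∑-const (δ k))
      where
      drop : ∀ w → z * (z + + 2 * w) + - k ≈ - k
      drop w = ≈-trans (+-≈ (∣⇒≈0 (∣m⇒∣m*n (z + + 2 * w) p∣z)) (≈-refl { - k})) (≡⇒≈ (+-identityˡ (- k)))
    off : ∀ {z} → p∤ z → ∑[ w ] (δ ((z + w) * (z + w) - w * w - k)) ≡ 1ℤ
    off {z} p∤z = trans (∑-cong λ w → cong δ (diff-squares-∤ z w k))
      (∑-δ-affine (+ 2 * z) (z * z - k) (∤-* (+ 2) z p-odd p∤z))

  #√ : ℤ → ℤ
  #√ u = ∑[ y ] (δ (y * y - u))

  #√-periodic : Periodic #√
  #√-periodic u≈v = ∑-cong λ y → δ-periodic (+-≈ (≈-refl {y * y}) (neg-≈ u≈v))

  #√-+-periodic : ∀ u → Periodic (λ s → #√ (u + s))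
  #√-+-periodic u s≈t = #√-periodic (+-≈ (≈-refl {u}) s≈t)

  #√-∣ : ∀ {u} → p∣ u → #√ u ≡ 1ℤ
  #√-∣ {u} p∣u = trans (∑-cong square) (∑-δ 0ℤ)
    where
    square : ∀ y → δ (y * y - u) ≡ δ (y - 0ℤ)
    square y = δ-⇔
      (λ d → ≈⇒∣ (∣⇒≈0 (reduce (∣-* y y (∣-≈ (≈-sym (cong-mod d)) p∣u)))))
      (λ d → ≈⇒∣ (≈-trans (∣⇒≈0 (∣m⇒∣m*n {m = y} y (≈0⇒∣ (cong-mod d)))) (≈-sym (∣⇒≈0 p∣u))))

  #√-square : ∀ y₀ {u} → p∤ u → y₀ * y₀ ≈ u → #√ u ≡ + 2
  #√-square y₀ {u} p∤u y₀²≈u = begin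
    ∑[ y ] (δ (y * y - u))                        ≡⟨ ∑-cong roots ⟩
    ∑[ y ] (δ (y - y₀) + δ (y - - y₀))            ≡⟨ ∑-+ (λ y → δ (y - y₀)) (λ y → δ (y - - y₀)) ⟩
    ∑[ y ] (δ (y - y₀)) + ∑[ y ] (δ (y - - y₀))   ≡⟨ cong₂ _+_ (∑-δ y₀) (∑-δ (- y₀)) ⟩
    + 2                                           ∎
    where
    p∤y₀ : p∤ y₀
    p∤y₀ d = p∤u (∣-≈ y₀²≈u (∣m⇒∣m*n y₀ d))
    factor : ∀ y z → y * y - z * z ≡ (y - z) * (y - - z)
    factor = solve-∀
    apart : ∀ y z → (y - - z) - (y - z) ≡ + 2 * z
    apart = solve-∀
    to-factors : ∀ y → δ (y * y - u) ≡ δ ((y - y₀) * (y - - y₀))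
    to-factors y = trans (δ-periodic (+-≈ (≈-refl {y * y}) (neg-≈ (≈-sym y₀²≈u)))) (cong δ (factor y y₀))
    roots : ∀ y → δ (y * y - u) ≡ δ (y - y₀) + δ (y - - y₀)
    roots y = trans (to-factors y) (split (+ p ∣? (y - y₀)) (+ p ∣? (y - - y₀)))
      where
      split : Dec (p∣ y - y₀) → Dec (p∣ y - - y₀) → δ ((y - y₀) * (y - - y₀)) ≡ δ (y - y₀) + δ (y - - y₀)
      -- A common zero of both factors would make `p` divide `2 y₀`, so the roots `y₀` and `- y₀`
      -- are distinct.
      split (yes d) (yes e) = contradiction (∣-≡ (apart y y₀) (∣m∣n⇒∣m-n e d)) (∤-* (+ 2) y₀ p-odd p∤y₀)
      split (yes d) (no ¬e) = trans (δ-∣ (∣m⇒∣m*n _ d)) (sym (cong₂ _+_ (δ-∣ d) (δ-∤ ¬e)))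
      split (no ¬d) (yes e) = trans (δ-∣ (∣n⇒∣m*n (y - y₀) e)) (sym (cong₂ _+_ (δ-∤ ¬d) (δ-∣ e)))
      split (no ¬d) (no ¬e) = trans (δ-∤ (∤-* _ _ ¬d ¬e)) (sym (cong₂ _+_ (δ-∤ ¬d) (δ-∤ ¬e)))

  #√-nonsquare : ∀ {u} → (∀ (i : Fin p) → ¬ rep i * rep i ≈ u) → #√ u ≡ 0ℤ
  #√-nonsquare nonsquare =
    trans (sum-cong-≗ λ i → δ-∤ (nonsquare i ∘ cong-mod)) (trans (sum-const p 0ℤ) (*-zeroʳ (+ p)))

  #√-legendre : ∀ u → #√ u ≡ 1ℤ + legendre u p
  #√-legendre u = go (+ p ∣? u) (any? λ (y : Fin p) → rep y ^ 2 ≡? u mod p)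
    where
    go : (du : Dec (p∣ u)) (sq : Dec (∃ λ (y : Fin p) → rep y ^ 2 ≡ u mod p)) →
         #√ u ≡ 1ℤ + (if does du then 0ℤ else if does sq then 1ℤ else -1ℤ)
    go (yes p∣u) _ = #√-∣ p∣u
    go (no p∤u) (yes (y , y²≡u)) =
      -- `y ^ 2` unfolds to `y * (y * 1ℤ)`; the substitution removes the trailing unit.
      #√-square (rep y) p∤u (cong-mod (subst (λ z → p∣ rep y * z - u) (*-identityʳ (rep y)) y²≡u))
    go (no p∤u) (no ¬sq) = #√-nonsquare λ i i²≈u →
      ¬sq (i , subst (λ z → p∣ rep i * z - u) (sym (*-identityʳ (rep i))) (≈⇒∣ i²≈u))

  -- Away from zero the count is 0 or 2, and these are the roots of `R * R = 2 R`. This quadratic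
  -- relation is what makes the variance of the conic counts vanish.
  #√-two-valued : ∀ {u} → p∤ u → #√ u * #√ u ≡ + 2 * #√ u
  #√-two-valued {u} p∤u with any? (λ (y : Fin p) → + p ∣? (rep y * rep y - u))
  ... | yes (y , y²≈u) = double (#√-square (rep y) p∤u (cong-mod y²≈u))
    where
    double : ∀ {k} → k ≡ + 2 → k * k ≡ + 2 * k
    double refl = refl
  ... | no ¬sq = double (#√-nonsquare λ i i²≈u → ¬sq (i , ≈⇒∣ i²≈u))
    where
    double : ∀ {k} → k ≡ 0ℤ → k * k ≡ + 2 * k
    double refl = refl

  -- Substituting `y ↦ h y` makes the unit `h * h` a common factor.
  #√-*-square : ∀ k h → p∤ h → #√ (k * (h * h)) ≡ #√ k
  #√-*-square k h p∤h = begin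
    ∑[ y ] (δ (y * y - k * (h * h)))
      ≡⟨ ∑-affine h 0ℤ p∤h periodic ⟨
    ∑[ y ] (δ ((h * y + 0ℤ) * (h * y + 0ℤ) - k * (h * h)))
      ≡⟨ ∑-cong (λ y → trans (cong δ (factor h y k)) (δ-*ˡ (h * h) (y * y - k) (∤-* h h p∤h p∤h))) ⟩
    ∑[ y ] (δ (y * y - k)) ∎
    where
    factor : ∀ h y k → (h * y + 0ℤ) * (h * y + 0ℤ) - k * (h * h) ≡ h * h * (y * y - k)
    factor = solve-∀
    periodic : Periodic (λ y → δ (y * y - k * (h * h)))
    periodic u≈v = δ-periodic (+-≈ (*-≈ u≈v u≈v) ≈-refl)

  #√-mean : ∀ u → ∑[ s ] (#√ (u + s)) ≡ + p
  #√-mean u = begin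
    ∑[ s ] (∑[ y ] (δ (y * y - (u + s))))  ≡⟨ ∑-swap (λ s y → δ (y * y - (u + s))) ⟩
    ∑[ y ] (∑[ s ] (δ (y * y - (u + s))))  ≡⟨ ∑-cong (λ y → trans (∑-cong λ s → flip y s) (∑-δ (y * y - u))) ⟩
    ∑[ _ ] 1ℤ                              ≡⟨ trans (∑-const 1ℤ) (*-identityʳ (+ p)) ⟩
    + p                                    ∎
    where
    flip-sub : ∀ y u s → y * y - (u + s) ≡ - (s - (y * y - u))
    flip-sub = solve-∀
    flip : ∀ y s → δ (y * y - (u + s)) ≡ δ (s - (y * y - u))
    flip y s = trans (cong δ (flip-sub y u s)) (δ-neg _)

  -- Expanding the first factor over its square roots `z` forces `s = z² - u`. The second factor
  -- then counts the `w` with `w² = z² - (u - v)`, a difference-of-squares problem.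
  #√-correlation : ∀ u v → ∑[ s ] (#√ (u + s) * #√ (v + s)) ≡ (+ p - 1ℤ) + + p * δ (u - v)
  #√-correlation u v = begin
    ∑[ s ] (#√ (u + s) * #√ (v + s))
      ≡⟨ ∑-cong (λ s → cong (_* #√ (v + s)) (∑-cong λ y → trans (cong δ (flip-sub y u s)) (δ-neg _))) ⟩
    ∑[ s ] (∑[ z ] (δ (s - (z * z - u))) * #√ (v + s))
      ≡⟨ ∑-pushforward (λ z → z * z - u) (#√-+-periodic v) ⟩
    ∑[ z ] (#√ (v + (z * z - u)))
      ≡⟨ ∑-cong (λ z → ∑-cong λ w → trans (cong δ (collect w v z u)) (δ-neg _)) ⟩
    ∑[ z ] (∑[ w ] (δ (z * z - w * w - (u - v))))
      ≡⟨ ∑∑-δ-diff-squares (u - v) ⟩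
    (+ p - 1ℤ) + + p * δ (u - v) ∎
    where
    flip-sub : ∀ y u s → y * y - (u + s) ≡ - (s - (y * y - u))
    flip-sub = solve-∀
    collect : ∀ w v z u → w * w - (v + (z * z - u)) ≡ - (z * z - w * w - (u - v))
    collect = solve-∀

  -- First and second moments of the point counts of `y² = F x + s`.

  #curve : (ℤ → ℤ) → ℤ → ℤ
  #curve F s = ∑[ x ] (#√ (F x + s))

  #curve-periodic : ∀ F → Periodic (#curve F)
  #curve-periodic F = ∑-periodic λ x → #√-+-periodic (F x)

  #collisions : (ℤ → ℤ) → ℤ
  #collisions F = ∑[ x ] (∑[ y ] (δ (F x - F y)))

  ∑-#curve : ∀ F → ∑ (#curve F) ≡ + p * + p
  ∑-#curve F = begin
    ∑[ s ] (∑[ x ] (#√ (F x + s)))  ≡⟨ ∑-swap (λ s x → #√ (F x + s)) ⟩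
    ∑[ x ] (∑[ s ] (#√ (F x + s)))  ≡⟨ ∑-cong (λ x → #√-mean (F x)) ⟩
    ∑[ _ ] (+ p)                   ≡⟨ ∑-const (+ p) ⟩
    + p * + p                      ∎

  -- The square is a double sum over `x` and `y`; the correlation of each pair is a constant plus a
  -- term present only when `F x` and `F y` collide.
  ∑-#curve² : ∀ F → ∑[ s ] (#curve F s * #curve F s) ≡ + p * (+ p * (+ p - 1ℤ)) + + p * #collisions F
  ∑-#curve² F = begin
    ∑[ s ] (#curve F s * #curve F s)
      ≡⟨ ∑-cong (λ s → ∑-product (λ x → #√ (F x + s)) (λ y → #√ (F y + s))) ⟩
    ∑[ s ] (∑[ x ] (∑[ y ] (#√ (F x + s) * #√ (F y + s))))
      ≡⟨ ∑-swap (λ s x → ∑[ y ] (#√ (F x + s) * #√ (F y + s))) ⟩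
    ∑[ x ] (∑[ s ] (∑[ y ] (#√ (F x + s) * #√ (F y + s))))
      ≡⟨ ∑-cong (λ x → ∑-swap (λ s y → #√ (F x + s) * #√ (F y + s))) ⟩
    ∑[ x ] (∑[ y ] (∑[ s ] (#√ (F x + s) * #√ (F y + s))))
      ≡⟨ ∑-cong (λ x → ∑-cong λ y → #√-correlation (F x) (F y)) ⟩
    ∑[ x ] (∑[ y ] ((+ p - 1ℤ) + + p * δ (F x - F y)))
      ≡⟨ ∑-cong (λ x → trans (∑-+ (λ _ → + p - 1ℤ) (λ y → + p * δ (F x - F y)))
                             (cong₂ _+_ (∑-const (+ p - 1ℤ)) (∑-*ˡ (+ p) (λ y → δ (F x - F y))))) ⟩
    ∑[ x ] (+ p * (+ p - 1ℤ) + + p * ∑[ y ] (δ (F x - F y)))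
      ≡⟨ trans (∑-+ (λ _ → + p * (+ p - 1ℤ)) (λ x → + p * ∑[ y ] (δ (F x - F y))))
               (cong₂ _+_ (∑-const (+ p * (+ p - 1ℤ))) (∑-*ˡ (+ p) (λ x → ∑[ y ] (δ (F x - F y))))) ⟩
    + p * (+ p * (+ p - 1ℤ)) + + p * #collisions F ∎

  -- The centre `n` is left free because two are used: the overall mean `p` for the second moment of
  -- the family, and the mean over nonzero parameters for conics.
  ∑-deviation² : ∀ F n → ∑[ s ] ((n - #curve F s) * (n - #curve F s)) ≡
    + p * (n * n) - + 2 * n * (+ p * + p) + (+ p * (+ p * (+ p - 1ℤ)) + + p * #collisions F)
  ∑-deviation² F n = begin
    ∑[ s ] ((n - C s) * (n - C s))
      ≡⟨ ∑-cong (λ s → expand n (C s)) ⟩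
    ∑[ s ] (n * n + - (+ 2 * n) * C s + C s * C s)
      ≡⟨ ∑-+ (λ s → n * n + - (+ 2 * n) * C s) (λ s → C s * C s) ⟩
    ∑[ s ] (n * n + - (+ 2 * n) * C s) + ∑[ s ] (C s * C s)
      ≡⟨ cong₂ _+_ (∑-+ (λ _ → n * n) (λ s → - (+ 2 * n) * C s)) (∑-#curve² F) ⟩
    ∑[ _ ] (n * n) + ∑[ s ] (- (+ 2 * n) * C s) + moment
      ≡⟨ cong (_+ moment) (cong₂ _+_ (∑-const (n * n))
                                     (trans (∑-*ˡ (- (+ 2 * n)) C) (cong (- (+ 2 * n) *_) (∑-#curve F)))) ⟩
    + p * (n * n) + - (+ 2 * n) * (+ p * + p) + moment
      ≡⟨ cong (_+ moment) (regroup (+ p) n) ⟩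
    + p * (n * n) - + 2 * n * (+ p * + p) + (+ p * (+ p * (+ p - 1ℤ)) + + p * #collisions F) ∎
    where
    C = #curve F
    moment = + p * (+ p * (+ p - 1ℤ)) + + p * #collisions F
    expand : ∀ n c → (n - c) * (n - c) ≡ n * n + - (+ 2 * n) * c + c * c
    expand = solve-∀
    regroup : ∀ q n → q * (n * n) + - (+ 2 * n) * (q * q) ≡ q * (n * n) - + 2 * n * (q * q)
    regroup = solve-∀

  -- Point counts of the conics `y² = k h² + m`.

  conic : ℤ → ℤ → ℤ
  conic k h = k * (h * h)

  #collisions-conic : ∀ k → p∤ k → #collisions (conic k) ≡ (+ p - 1ℤ) + + p
  #collisions-conic k p∤k = begin
    ∑[ x ] (∑[ y ] (δ (conic k x - conic k y)))
      ≡⟨ ∑-cong (λ x → ∑-cong λ y → trans (cong δ (factor k x y)) (δ-*ˡ k _ p∤k)) ⟩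
    ∑[ x ] (∑[ y ] (δ (x * x - y * y - 0ℤ)))
      ≡⟨ ∑∑-δ-diff-squares 0ℤ ⟩
    (+ p - 1ℤ) + + p * δ 0ℤ
      ≡⟨ cong (λ d → (+ p - 1ℤ) + + p * d) (δ-∣ (divides 0ℤ refl)) ⟩
    (+ p - 1ℤ) + + p * 1ℤ
      ≡⟨ cong (_+_ (+ p - 1ℤ)) (*-identityʳ (+ p)) ⟩
    (+ p - 1ℤ) + + p ∎
    where
    factor : ∀ k x y → k * (x * x) - k * (y * y) ≡ k * (x * x - y * y - 0ℤ)
    factor = solve-∀

  -- The conic degenerates to `y² = k h²`: `h` in the zero class gives one point, and every other
  -- `h` scales out of the equation.
  #conic-∣ : ∀ k {m} → p∣ m → #curve (conic k) m ≡ 1ℤ + (+ p - 1ℤ) * #√ k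
  #conic-∣ k {m} p∣m = ∑-split-const 1ℤ (#√ k)
    (λ {h} p∣h → #√-∣ (∣m∣n⇒∣m+n (∣n⇒∣m*n k (∣m⇒∣m*n h p∣h)) p∣m))
    (λ {h} p∤h → trans (#√-periodic (≈-trans (+-≈ (≈-refl {conic k h}) (∣⇒≈0 p∣m)) (≡⇒≈ (+-identityʳ (conic k h)))))
                       (#√-*-square k h p∤h))

  -- The deviations from the mean over nonzero parameters have square sum zero, so each of them
  -- vanishes.
  #conic-∤ : ∀ k {m} → p∤ k → p∤ m → #curve (conic k) m ≡ + p + 1ℤ - #√ k
  #conic-∤ k {m} p∤k p∤m with ∃-rep m
  ... | i , i≈m = trans (#curve-periodic (conic k) (≈-sym i≈m)) (sym (i-j≡0⇒i≡j n (C (rep i)) vanish))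
    where
    -- All fibres together have `p²` points and the degenerate one has `1 + (p - 1) * #√ k`;
    -- dividing the difference by `p - 1` gives this mean.
    n = + p + 1ℤ - #√ k
    C = #curve (conic k)
    deviation² : ℤ → ℤ
    deviation² s = (n - C s) * (n - C s)
    -- The factor `1ℤ - δ s` discards the degenerate fibre, whose count is not `n`.
    punctured : ℤ → ℤ
    punctured s = (1ℤ - δ s) * (n - C s)
    -- With `C₀` the degenerate count and `N` the number of collisions, the left side equals
    -- `q * (q - 1) * (2 R - R²)`.
    variance : ∀ q R {C₀ N} → C₀ ≡ 1ℤ + (q - 1ℤ) * R → N ≡ (q - 1ℤ) + q → R * R ≡ + 2 * R →
      q * ((q + 1ℤ - R) * (q + 1ℤ - R)) - + 2 * (q + 1ℤ - R) * (q * q) + (q * (q * (q - 1ℤ)) + q * N)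
        + (0ℤ - (q + 1ℤ - R - C₀) * (q + 1ℤ - R - C₀)) ≡ 0ℤ
    variance q R refl refl R²≡2R =
      trans (factor q R) (trans (cong (λ x → q * (q - 1ℤ) * (+ 2 * R - x)) R²≡2R) (cancel q R))
      where
      factor : ∀ q R →
        q * ((q + 1ℤ - R) * (q + 1ℤ - R)) - + 2 * (q + 1ℤ - R) * (q * q)
          + (q * (q * (q - 1ℤ)) + q * ((q - 1ℤ) + q))
          + (0ℤ - (q + 1ℤ - R - (1ℤ + (q - 1ℤ) * R)) * (q + 1ℤ - R - (1ℤ + (q - 1ℤ) * R)))
        ≡ q * (q - 1ℤ) * (+ 2 * R - R * R)
      factor = solve-∀
      cancel : ∀ q R → q * (q - 1ℤ) * (+ 2 * R - + 2 * R) ≡ 0ℤ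
      cancel = solve-∀
    on-eq : ∀ y → (1ℤ - 1ℤ) * y * ((1ℤ - 1ℤ) * y) ≡ 0ℤ
    on-eq = solve-∀
    off-eq : ∀ y → (1ℤ - 0ℤ) * y * ((1ℤ - 0ℤ) * y) ≡ y * y
    off-eq = solve-∀
    on : ∀ {s} → p∣ s → punctured s * punctured s ≡ 0ℤ
    on {s} p∣s = trans (cong (λ d → (1ℤ - d) * (n - C s) * ((1ℤ - d) * (n - C s))) (δ-∣ p∣s)) (on-eq (n - C s))
    off : ∀ {s} → p∤ s → punctured s * punctured s ≡ deviation² s
    off {s} p∤s = trans (cong (λ d → (1ℤ - d) * (n - C s) * ((1ℤ - d) * (n - C s))) (δ-∤ p∤s)) (off-eq (n - C s))
    ∑-punctured² : ∑[ s ] (punctured s * punctured s) ≡ 0ℤ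
    ∑-punctured² = begin
      ∑[ s ] (punctured s * punctured s)
        ≡⟨ ∑-split 0ℤ {deviation²} (λ u≈v → cong (λ c → (n - c) * (n - c)) (#curve-periodic (conic k) u≈v)) on off ⟩
      ∑ deviation² + (0ℤ - deviation² 0ℤ)
        ≡⟨ cong (_+ (0ℤ - deviation² 0ℤ)) (∑-deviation² (conic k) n) ⟩
      + p * (n * n) - + 2 * n * (+ p * + p) + (+ p * (+ p * (+ p - 1ℤ)) + + p * #collisions (conic k))
        + (0ℤ - deviation² 0ℤ)
        ≡⟨ variance (+ p) (#√ k) (#conic-∣ k (divides 0ℤ refl)) (#collisions-conic k p∤k) (#√-two-valued p∤k) ⟩
      0ℤ ∎
    vanish : n - C (rep i) ≡ 0ℤ
    -- Since `rep i` is congruent to the unit `m`, the puncturing factor at `i` is one.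
    vanish = trans (sym (trans (cong (λ d → (1ℤ - d) * (n - C (rep i))) (δ-∤ λ d → p∤m (∣-≈ i≈m d))) (*-identityˡ _)))
      (sum-squares≡0⇒≡0 (punctured ∘ rep) ∑-punctured² i)

  -- Completing the square: multiplication by the unit `4 α` turns the quadratic into `(2 α x + β)²`
  -- minus its discriminant, and `2 α x + β` runs through all residues.
  #quadratic-roots : ∀ α β γ → p∤ α → ∑[ x ] (δ (α * (x * x) + β * x + γ)) ≡ #√ (β * β - + 4 * α * γ)
  #quadratic-roots α β γ p∤α = begin
    ∑[ x ] (δ (α * (x * x) + β * x + γ))
      ≡⟨ ∑-cong (λ x → trans (cong δ (sym (complete α β γ x))) (δ-*ˡ (+ 2 * (+ 2 * α)) _ (∤-* (+ 2) _ p-odd p∤2α))) ⟨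
    ∑[ x ] (δ ((+ 2 * α * x + β) * (+ 2 * α * x + β) - (β * β - + 4 * α * γ)))
      ≡⟨ ∑-affine (+ 2 * α) β p∤2α (λ u≈v → δ-periodic (+-≈ (*-≈ u≈v u≈v) (≈-refl { - (β * β - + 4 * α * γ)}))) ⟩
    #√ (β * β - + 4 * α * γ) ∎
    where
    p∤2α = ∤-* (+ 2) α p-odd p∤α
    complete : ∀ α β γ x → + 2 * (+ 2 * α) * (α * (x * x) + β * x + γ) ≡
      (+ 2 * α * x + β) * (+ 2 * α * x + β) - (β * β - + 4 * α * γ)
    complete = solve-∀

  -- From point counts to the second moment of a linear twist.

  #points≡∑-#√ : ∀ f t → + #points f p t ≡ ∑[ x ] (#√ (f t x))
  #points≡∑-#√ f t = trans
    (length-filter-cartesianProduct {m = p} {n = p} (λ (x , y) → rep y ^ 2 ≡? f t (rep x) mod p) id id)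
    (∑-cong λ x → ∑-cong λ y → trans (sym (δ-def (y ^ 2 - f t x))) (cong (λ z → δ (y * z - f t x)) (*-identityʳ y)))

  -- As `d` is a unit, `d * t` runs through all residues, so the second moment is the squared
  -- deviation of `#curve F` from its mean `p`.
  A₂-linear-twist : ∀ F d → p∤ d → A₂ (λ t x → F x + d * t) p ≡ + p * #collisions F - + p * + p
  A₂-linear-twist F d p∤d = begin
    A₂ (λ t x → F x + d * t) p
      ≡⟨ ∑-cong (λ t → trans (cong (λ n → (+ p - n) ^ 2) (#points≡∑-#√ (λ t x → F x + d * t) t))
                             (square (+ p - #curve F (d * t)))) ⟩
    ∑[ t ] (g (d * t))
      ≡⟨ ∑-cong (λ t → cong g (sym (+-identityʳ (d * t)))) ⟩
    ∑[ t ] (g (d * t + 0ℤ))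
      ≡⟨ ∑-affine d 0ℤ p∤d (λ u≈v → cong (λ c → (+ p - c) * (+ p - c)) (#curve-periodic F u≈v)) ⟩
    ∑ g
      ≡⟨ ∑-deviation² F (+ p) ⟩
    + p * (+ p * + p) - + 2 * + p * (+ p * + p) + (+ p * (+ p * (+ p - 1ℤ)) + + p * #collisions F)
      ≡⟨ collect (+ p) (#collisions F) ⟩
    + p * #collisions F - + p * + p ∎
    where
    g : ℤ → ℤ
    g s = (+ p - #curve F s) * (+ p - #curve F s)
    square : ∀ i → i ^ 2 ≡ i * i
    square i = cong (i *_) (*-identityʳ i)
    collect : ∀ q n → q * (q * q) - + 2 * q * (q * q) + (q * (q * (q - 1ℤ)) + q * n) ≡ q * n - q * q
    collect = solve-∀

  -- Collisions of the cubic.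

  module _ (p∤3 : p∤ + 3) (a b c : ℤ) where

    private
      F : ℤ → ℤ
      F = cubic a b c

      D : ℤ
      D = a ^ 2 - + 12 * b

      F-≈ : ∀ {u v} → u ≈ v → F u ≈ F v
      F-≈ {u} {v} u≈v =
        +-≈ (+-≈ (+-≈ (*-≈ (≈-refl {+ 4}) (*-≈ u≈v u²≈v²)) (*-≈ (≈-refl {a}) u²≈v²)) (*-≈ (≈-refl {b}) u≈v))
            (≈-refl {c})
        where
        u²≈v² : u ^ 2 ≈ v ^ 2
        u²≈v² = *-≈ u≈v (*-≈ u≈v (≈-refl {1ℤ}))

      p∤4 : p∤ + 4
      p∤4 = ∤-* (+ 2) (+ 2) p-odd p-odd

      p∤12 : p∤ + 12
      p∤12 = ∤-* (+ 4) (+ 3) p∤4 p∤3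

      p∤-48 : p∤ - + 48
      p∤-48 d = ∤-* (+ 12) (+ 4) p∤12 p∤4 (∣m⇒∣-m d)

    -- For `x = h + y` with `h` a unit, a collision is a root `y` of a quadratic with leading
    -- coefficient 12, a unit as `p` divides neither 2 nor 3. Its root count is `R h`, and summing
    -- `R` over `h` counts a conic.
    #collisions-cubic-conic : #collisions (cubic a b c) ≡ #curve (conic (- + 48)) (D * + 4) + (+ p - #√ D)
    #collisions-cubic-conic = begin
      ∑[ x ] (∑[ y ] (δ (F x - F y)))
        ≡⟨ ∑-swap (λ x y → δ (F x - F y)) ⟩
      ∑[ y ] (∑[ x ] (δ (F x - F y)))
        ≡⟨ ∑-cong (λ y → ∑-shift y (λ u≈v → δ-periodic (+-≈ (F-≈ u≈v) (≈-refl { - F y})))) ⟨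
      ∑[ y ] (∑[ h ] (δ (F (h + y) - F y)))
        ≡⟨ ∑-swap (λ h y → δ (F (h + y) - F y)) ⟨
      ∑[ h ] (∑[ y ] (δ (F (h + y) - F y)))
        -- For `h` in the zero class all `p` values of `y` collide, whereas `R 0ℤ` is
        -- `#√ (4 D) = #√ D`; hence the correction `+ p - #√ D`.
        ≡⟨ ∑-split (+ p) {R} R-periodic on off ⟩
      ∑ R + (+ p - R 0ℤ)
        ≡⟨ cong (λ k → ∑ R + (+ p - k)) (trans (cong #√ (+-identityˡ (D * + 4))) (#√-*-square D (+ 2) p-odd)) ⟩
      ∑ R + (+ p - #√ D) ∎
      where
      R : ℤ → ℤ
      R h = #√ (conic (- + 48) h + D * + 4)
      R-periodic : Periodic R
      R-periodic u≈v = #√-periodic (+-≈ (*-≈ (≈-refl { - + 48}) (*-≈ u≈v u≈v)) (≈-refl {D * + 4}))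
      β γ : ℤ → ℤ
      β h = + 12 * h + + 2 * a
      γ h = + 4 * (h * h) + a * h + b
      -- Powers are unfolded here and below because the ring solver does not handle _^_ on ℤ.
      chord : ∀ a b c h y →
        (+ 4 * ((h + y) * ((h + y) * ((h + y) * 1ℤ))) + a * ((h + y) * ((h + y) * 1ℤ)) + b * (h + y) + c)
          - (+ 4 * (y * (y * (y * 1ℤ))) + a * (y * (y * 1ℤ)) + b * y + c)
        ≡ h * (+ 12 * (y * y) + (+ 12 * h + + 2 * a) * y + (+ 4 * (h * h) + a * h + b))
      chord = solve-∀
      discriminant : ∀ a b h →
        (+ 12 * h + + 2 * a) * (+ 12 * h + + 2 * a) - + 4 * + 12 * (+ 4 * (h * h) + a * h + b)
        ≡ - + 48 * (h * h) + (a * (a * 1ℤ) - + 12 * b) * + 4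
      discriminant = solve-∀
      on : ∀ {h} → p∣ h → ∑[ y ] (δ (F (h + y) - F y)) ≡ + p
      on {h} p∣h = trans (∑-cong λ y → trans (cong δ (chord a b c h y)) (δ-∣ (∣m⇒∣m*n _ p∣h)))
        (trans (∑-const 1ℤ) (*-identityʳ (+ p)))
      off : ∀ {h} → p∤ h → ∑[ y ] (δ (F (h + y) - F y)) ≡ R h
      off {h} p∤h = begin
        ∑[ y ] (δ (F (h + y) - F y))
          ≡⟨ ∑-cong (λ y → trans (cong δ (chord a b c h y)) (δ-*ˡ h _ p∤h)) ⟩
        ∑[ y ] (δ (+ 12 * (y * y) + β h * y + γ h))
          ≡⟨ #quadratic-roots (+ 12) (β h) (γ h) p∤12 ⟩
        #√ (β h * β h - + 4 * + 12 * γ h)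
          ≡⟨ cong #√ (discriminant a b h) ⟩
        R h ∎

    #collisions-cubic-∤ : p∤ D → #collisions (cubic a b c) ≡ + p + 1ℤ - #√ (- + 48) + (+ p - #√ D)
    #collisions-cubic-∤ p∤D = trans #collisions-cubic-conic
      (cong (_+ (+ p - #√ D)) (#conic-∤ (- + 48) p∤-48 (∤-* D (+ 4) p∤D p∤4)))

    #collisions-cubic-∣ : p∣ D → #collisions (cubic a b c) ≡ 1ℤ + (+ p - 1ℤ) * #√ (- + 48) + (+ p - 1ℤ)
    #collisions-cubic-∣ p∣D = trans #collisions-cubic-conic
      (cong₂ (λ m n → m + (+ p - n)) (#conic-∣ (- + 48) (∣m⇒∣m*n (+ 4) p∣D)) (#√-∣ p∣D))

-- Excluding 2 and 3 makes 12 and -48 units, and `p` not dividing `d` lets the parameter sweep all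
-- residues. The dichotomy on `a² - 12 b` is read modulo `p` and separates smooth from degenerate
-- conics.
lemma2p2 : (p : ℕ) → Prime p → p ≢ 2 → p ≢ 3 →
    (a b c d : ℤ) → ¬ (+ p ∣ d) →
    (¬ (a ^ 2 - + 12 * b ≡ + 0 mod p) →
    A₂ (E a b c d) p ≡
    (+ p) ^ 2 - + p - + p * legendre (- (+ 48)) p - + p * legendre (a ^ 2 - + 12 * b) p)
    ×
    (a ^ 2 - + 12 * b ≡ + 0 mod p →
    A₂ (E a b c d) p ≡
    (+ p) ^ 2 - + p + + p * (+ p - + 1) * legendre (- (+ 48)) p)
lemma2p2 p p-prime p≢2 p≢3 a b c d p∤d = generic , degenerate
  where
  p-odd : ¬ + p ∣ + 2
  p-odd = p≢2 ∘ prime-∣⇒≡ p-prime prime[2]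
  p∤3 : ¬ + p ∣ + 3
  p∤3 = p≢3 ∘ prime-∣⇒≡ p-prime (from-yes (prime? 3))
  open Modulo p p-prime
  open OddModulo p p-prime p-odd

  F = cubic a b c
  D = a ^ 2 - + 12 * b
  χ : ℤ → ℤ
  χ u = legendre u p

  generic-value : ∀ q x y → q * (q + 1ℤ - (1ℤ + x) + (q - (1ℤ + y))) - q * q ≡ q * (q * 1ℤ) - q - q * x - q * y
  generic-value = solve-∀
  degenerate-value : ∀ q x → q * (1ℤ + (q - 1ℤ) * (1ℤ + x) + (q - 1ℤ)) - q * q ≡ q * (q * 1ℤ) - q + q * (q - + 1) * x
  degenerate-value = solve-∀

  generic : ¬ (D ≡ + 0 mod p) → A₂ (E a b c d) p ≡ (+ p) ^ 2 - + p - + p * χ (- + 48) - + p * χ D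
  generic D≢0 = begin
    A₂ (E a b c d) p
      ≡⟨ A₂-linear-twist F d p∤d ⟩
    + p * #collisions F - + p * + p
      ≡⟨ cong (λ n → + p * n - + p * + p) (#collisions-cubic-∤ p∤3 a b c (D≢0 ∘ ≈⇒∣ ∘ ∣⇒≈0)) ⟩
    + p * (+ p + 1ℤ - #√ (- + 48) + (+ p - #√ D)) - + p * + p
      ≡⟨ cong₂ (λ m n → + p * (+ p + 1ℤ - m + (+ p - n)) - + p * + p) (#√-legendre (- + 48)) (#√-legendre D) ⟩
    + p * (+ p + 1ℤ - (1ℤ + χ (- + 48)) + (+ p - (1ℤ + χ D))) - + p * + p
      ≡⟨ generic-value (+ p) (χ (- + 48)) (χ D) ⟩
    (+ p) ^ 2 - + p - + p * χ (- + 48) - + p * χ D ∎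

  degenerate : D ≡ + 0 mod p → A₂ (E a b c d) p ≡ (+ p) ^ 2 - + p + + p * (+ p - + 1) * χ (- + 48)
  degenerate D≡0 = begin
    A₂ (E a b c d) p
      ≡⟨ A₂-linear-twist F d p∤d ⟩
    + p * #collisions F - + p * + p
      ≡⟨ cong (λ n → + p * n - + p * + p) (#collisions-cubic-∣ p∤3 a b c (≈0⇒∣ (cong-mod D≡0))) ⟩
    + p * (1ℤ + (+ p - 1ℤ) * #√ (- + 48) + (+ p - 1ℤ)) - + p * + p
      ≡⟨ cong (λ m → + p * (1ℤ + (+ p - 1ℤ) * m + (+ p - 1ℤ)) - + p * + p) (#√-legendre (- + 48)) ⟩
    + p * (1ℤ + (+ p - 1ℤ) * (1ℤ + χ (- + 48)) + (+ p - 1ℤ)) - + p * + p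
      ≡⟨ degenerate-value (+ p) (χ (- + 48)) ⟩
    (+ p) ^ 2 - + p + + p * (+ p - + 1) * χ (- + 48) ∎
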